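{- Let $\mathcal{S}=\{s_1,s_2,\ldots,s_k\}$ be a finite set of $k$ distinct integers, let $\mathcal{S}^*=\mathcal{S}\setminus\{0\}$, and let $n\ge 1$ be an integer. Let $\mathcal{R}_n^*(\mathcal{S})$ be the set of polynomials $f(X)=a_nX^n+a_{n-1}X^{n-1}+\cdots+a_1X+a_0$ with $a_i\in\mathcal{S}$ for all $0\le i\le n$ and $a_0a_n\neq 0$ that are reducible over $\mathbb{Z}[X]$. Let $M$ be a positive integer such that $$s_i\not\equiv s_j \pmod{M}\quad\text{for all } i\neq j\quad (i,j=1,2,\ldots,k).$$ Then $$|\mathcal{R}_n^*(\mathcal{S})|\le 4(n-1)M^{n-2}\left(\sum_{a\in\mathcal{S}^*}d(a)\right)^2.$$
   Context: For a nonzero integer $a$ (positive or negative), $d(a)$ denotes the number of positive divisors of $a$. A polynomial $f\in\mathbb{Z}[X]$ is called reducible if $f=pq$ for some $p,q\in\mathbb{Z}[X]$ both of positive degree (a factorization that merely extracts a non-unit integer constant does not count). -}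

module Defs where

open import Data.Integer using (ℤ; +_; 0ℤ; ∣_∣; _-_; _≟_) renaming (_+_ to _+ℤ_; _*_ to _*ℤ_)
open import Data.Integer.Divisibility using (_∣_)
open import Data.List using (List; []; _∷_; map; filter; length; upTo)
open import Data.List.Membership.Propositional using (_∈_)
open import Data.List.Relation.Unary.All using (All)
open import Data.List.Relation.Unary.Unique.Propositional using (Unique)
open import Data.Nat using (ℕ; zero; suc; _≤_; _<_)
import Data.Nat.Divisibility as ℕ
open import Data.Product using (∃; ∃₂; _×_)
open import Data.Vec using (Vec; head; last; toList)
import Data.Vec.Relation.Unary.All as Vec
open import Relation.Binary.PropositionalEquality using (_≡_; _≢_)
open import Relation.Nullary.Decidable using (¬?)

-- Intended for a ≢ 0ℤ; positive divisors of such an a lie in 1 … ∣ a ∣.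
d : ℤ → ℕ
d a = length (filter (ℕ._∣? ∣ a ∣) (map suc (upTo ∣ a ∣)))

_≡_mod_ : ℤ → ℤ → ℕ → Set
a ≡ b mod M = (+ M) ∣ (a - b)

-- ℤ[X]: coefficient lists, constant term first. Trailing zeros are allowed,
-- so equality of polynomials is _≈_ and not equality of lists.
Poly : Set
Poly = List ℤ

coeff : Poly → ℕ → ℤ
coeff []      _       = 0ℤ
coeff (a ∷ p) zero    = a
coeff (a ∷ p) (suc i) = coeff p i

infix 4 _≈_
_≈_ : Poly → Poly → Set
p ≈ q = ∀ i → coeff p i ≡ coeff q i

infixl 6 _⊕_
_⊕_ : Poly → Poly → Poly
[]      ⊕ q       = q
(a ∷ p) ⊕ []      = a ∷ p
(a ∷ p) ⊕ (b ∷ q) = (a +ℤ b) ∷ (p ⊕ q)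

-- (a + X p) q = a q + X (p q)
infixl 7 _⊗_
_⊗_ : Poly → Poly → Poly
[]      ⊗ q = []
(a ∷ p) ⊗ q = map (a *ℤ_) q ⊕ (0ℤ ∷ (p ⊗ q))

HasDegree : Poly → ℕ → Set
HasDegree p m = coeff p m ≢ 0ℤ × (∀ i → m < i → coeff p i ≡ 0ℤ)

PositiveDegree : Poly → Set
PositiveDegree p = ∃ λ m → 1 ≤ m × HasDegree p m

Reducible : Poly → Set
Reducible f = ∃₂ λ p q → PositiveDegree p × PositiveDegree q × f ≈ p ⊗ q

_∖0 : List ℤ → List ℤ
S ∖0 = filter (λ a → ¬? (a ≟ 0ℤ)) S

-- A polynomial aₙXⁿ + ⋯ + a₀ is given by the vector (a₀ , … , aₙ). Vectors of
-- a fixed length are equal exactly when the polynomials are, so counting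
-- vectors counts polynomials.
ℛ* : List ℤ → (n : ℕ) → Vec ℤ (suc n) → Set
ℛ* S n a = Vec.All (_∈ S) a × head a *ℤ last a ≢ 0ℤ × Reducible (toList a)

-- ∣ P ∣ ≤ B for a set P not presented with a decision procedure: any
-- list of distinct elements of P has length at most B.
CardinalityAtMost : {A : Set} → (A → Set) → ℕ → Set
CardinalityAtMost P B = ∀ xs → Unique xs → All P xs → length xs ≤ B

{-# OPTIONS --safe #-}
-- If f = p q with deg p = k ≥ 1 and deg q = n − k ≥ 1, then a₀ = p₀ q₀ and
-- aₙ = pₖ qₙ₋ₖ, so each of the pairs (p₀ , q₀) and (pₖ , qₙ₋ₖ) is one of the
-- 2 Σ d(a) factorisations of elements of S*. The n − 2 remaining coefficients
-- of p and q matter only modulo M: they determine f modulo M, and f is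
-- determined by its reduction because M separates S.
module Submission where

open import Defs
open import Data.Integer using (ℤ; +_; 0ℤ; ∣_∣; sign; _◃_; -_; _-_; _≟_; ≢-nonZero)
  renaming (_+_ to _+ℤ_; _*_ to _*ℤ_)
open import Data.Integer.DivMod using (_%ℕ_; _/ℕ_; n%ℕd<d; a≡a%ℕn+[a/ℕn]*n)
import Data.Integer.Divisibility.Signed as Signed
import Data.Integer.Properties as ℤ
import Data.Integer.Tactic.RingSolver as ℤ-Solver
open import Data.Fin using (Fin)
import Data.Fin.Properties as Fin
open import Data.List using (List; []; _∷_; map; sum; length; lookup; filter; upTo; concatMap;
  cartesianProduct; cartesianProductWith)
open import Data.List.Membership.Propositional using (_∈_; lose)
open import Data.List.Membership.Propositional.Properties
  using (∈-map⁺; ∈-filter⁺; ∈-upTo⁺; ∈-concatMap⁺; ∈-cartesianProduct⁺; ∈-cartesianProductWith⁺)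
open import Data.List.Properties using (length-++; length-map; length-upTo; length-removeAt′)
open import Data.List.Relation.Unary.All using (All; []; _∷_)
import Data.List.Relation.Unary.All as All
open import Data.List.Relation.Unary.All.Properties using (all-upTo)
open import Data.List.Relation.Unary.Any using (Any; here; there; index; _─_)
open import Data.List.Relation.Unary.Any.Properties using (lookup-index; concatMap⁺)
open import Data.List.Relation.Unary.AllPairs using ([]; _∷_)
open import Data.List.Relation.Unary.Unique.Propositional using (Unique)
open import Data.Nat using (ℕ; zero; suc; _+_; _*_; _^_; _∸_; _≤_; _<_; s≤s; z≤n; NonZero; _/_)
open import Data.Nat.Divisibility using (_∣?_; m∣m*n)
open import Data.Nat.DivMod using (m*n/n≡m)
import Data.Nat.Properties as ℕ
open import Data.Nat.Tactic.RingSolver using (solve-∀)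
open import Data.Product using (∃; _×_; _,_)
import Data.Sign as Sign
import Data.Sign.Properties as Sign
open import Data.Sum using (inj₁; inj₂)
open import Data.Vec using (Vec; []; _∷_; head; last; toList)
import Data.Vec.Relation.Unary.All as Vec
open import Function using (_∘_)
open import Relation.Binary.PropositionalEquality
  using (_≡_; _≢_; refl; sym; trans; cong; cong₂; subst; module ≡-Reasoning)
open import Relation.Nullary using (¬_; yes; no; contradiction)
open import Relation.Nullary.Decidable using (¬?)

-- Counting in lists.

─⁺ : {A : Set} {P Q : A → Set} {xs : List A} (p : Any P xs) → Any Q xs →
  (∀ x → P x → ¬ Q x) → Any Q (xs ─ p)
─⁺ (here px)  (here qx)  disjoint = contradiction qx (disjoint _ px)
─⁺ (here px)  (there q)  disjoint = q
─⁺ (there p)  (here qx)  disjoint = here qx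
─⁺ (there p)  (there q)  disjoint = there (─⁺ p q disjoint)

module _ {A B : Set} where

  -- Each `x` uses up the code that its witness in `cs` points to. By injectivity no other element
  -- of the list is related to that code, so the remaining witnesses survive its deletion (`─⁺`) and
  -- the induction continues with one code fewer. `R` may relate an element to several codes.
  pigeonhole : {P : A → Set} (R : A → B → Set) →
    (∀ {x y} c → P x → P y → R x c → R y c → x ≡ y) →
    ∀ xs cs → Unique xs → All P xs → All (λ x → Any (R x) cs) xs → length xs ≤ length cs
  pigeonhole R inj []       cs _            _          _          = z≤n
  pigeonhole R inj (x ∷ xs) cs (x≢ ∷ xs!) (px ∷ pxs) (rx ∷ rxs) =
    subst (suc (length xs) ≤_) (sym (length-removeAt′ cs (index rx)))
      (s≤s (pigeonhole R inj xs (cs ─ rx) xs! pxs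
        (All.map (λ { (x≢y , py , ry) → ─⁺ rx ry λ c rxc ryc → x≢y (inj c px py rxc ryc) })
          (All.zip (x≢ , All.zip (pxs , rxs))))))

  length-concatMap : (f : A → List B) {c : ℕ} {xs : List A} →
    All (λ x → length (f x) ≡ c) xs → length (concatMap f xs) ≡ length xs * c
  length-concatMap f []                       = refl
  length-concatMap f (_∷_ {x = x} fx fxs) =
    trans (length-++ (f x)) (cong₂ _+_ fx (length-concatMap f fxs))

  length-cartesianProductWith : {C : Set} (f : A → B → C) (xs : List A) (ys : List B) →
    length (cartesianProductWith f xs ys) ≡ length xs * length ys
  length-cartesianProductWith f []       ys = refl
  length-cartesianProductWith f (x ∷ xs) ys =
    trans (length-++ (map (f x) ys))
      (cong₂ _+_ (length-map (f x) ys) (length-cartesianProductWith f xs ys))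

-- Coefficients of products.

-- Convolution of coefficient sequences: being a function of the sequences, it
-- does not see the trailing zeros of the lists.
conv : (ℕ → ℤ) → (ℕ → ℤ) → ℕ → ℤ
conv F G zero    = F 0 *ℤ G 0
conv F G (suc i) = F 0 *ℤ G (suc i) +ℤ conv (F ∘ suc) G i

conv-zero : ∀ F G i → (∀ j l → j + l ≡ i → F j *ℤ G l ≡ 0ℤ) → conv F G i ≡ 0ℤ
conv-zero F G zero    z = z 0 0 refl
conv-zero F G (suc i) z =
  cong₂ _+ℤ_ (z 0 (suc i) refl) (conv-zero (F ∘ suc) G i λ j l eq → z (suc j) l (cong suc eq))

0*≡0 : ∀ {a} b → a ≡ 0ℤ → a *ℤ b ≡ 0ℤ
0*≡0 b refl = ℤ.*-zeroˡ b

*0≡0 : ∀ a {b} → b ≡ 0ℤ → a *ℤ b ≡ 0ℤ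
*0≡0 a refl = ℤ.*-zeroʳ a

VanishesAbove : (ℕ → ℤ) → ℕ → Set
VanishesAbove F m = ∀ i → m < i → F i ≡ 0ℤ

-- If `j + j′` exceeds `m + l`, then `j` exceeds `m` or `j′` exceeds `l`, so one factor of each
-- summand vanishes.
conv-vanishesAbove : ∀ {F G m l} → VanishesAbove F m → VanishesAbove G l →
  VanishesAbove (conv F G) (m + l)
conv-vanishesAbove {F} {G} {m} {l} Fm Gl i m+l<i = conv-zero F G i λ j j′ eq →
  case-split j j′ (subst (m + l <_) (sym eq) m+l<i)
  where
  case-split : ∀ j j′ → m + l < j + j′ → F j *ℤ G j′ ≡ 0ℤ
  case-split j j′ lt with m ℕ.<? j
  ... | yes m<j = 0*≡0 (G j′) (Fm j m<j)
  ... | no  m≮j with l ℕ.<? j′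
  ...   | yes l<j′ = *0≡0 (F j) (Gl j′ l<j′)
  ...   | no  l≮j′ =
    contradiction lt (ℕ.≤⇒≯ (ℕ.+-mono-≤ (ℕ.≮⇒≥ m≮j) (ℕ.≮⇒≥ l≮j′)))

-- Induction on `m` removes the summands with index in `F` below `m`: there the index in `G` is
-- above `l`. Once `m` is 0, the summands after the first contain a vanishing value of `F`.
conv-top : ∀ F G m l → VanishesAbove F m → VanishesAbove G l →
  conv F G (m + l) ≡ F m *ℤ G l
conv-top F G zero    zero    Fm Gl = refl
conv-top F G zero    (suc l) Fm Gl =
  trans (cong (F 0 *ℤ G (suc l) +ℤ_)
          (conv-zero (F ∘ suc) G l λ j j′ _ → 0*≡0 (G j′) (Fm (suc j) (s≤s z≤n))))
    (ℤ.+-identityʳ _)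
conv-top F G (suc m) l       Fm Gl =
  trans (cong₂ _+ℤ_ (*0≡0 (F 0) (Gl (suc (m + l)) (s≤s (ℕ.m≤n+m l m))))
          (conv-top (F ∘ suc) G m l (λ i m<i → Fm (suc i) (s≤s m<i)) Gl))
    (ℤ.+-identityˡ _)

coeff-⊕ : ∀ p q i → coeff (p ⊕ q) i ≡ coeff p i +ℤ coeff q i
coeff-⊕ []      q       i       = sym (ℤ.+-identityˡ _)
coeff-⊕ (a ∷ p) []      i       = sym (ℤ.+-identityʳ _)
coeff-⊕ (a ∷ p) (b ∷ q) zero    = refl
coeff-⊕ (a ∷ p) (b ∷ q) (suc i) = coeff-⊕ p q i

coeff-map-* : ∀ a q i → coeff (map (a *ℤ_) q) i ≡ a *ℤ coeff q i
coeff-map-* a []      i       = sym (ℤ.*-zeroʳ a)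
coeff-map-* a (b ∷ q) zero    = refl
coeff-map-* a (b ∷ q) (suc i) = coeff-map-* a q i

coeff-⊗ : ∀ p q i → coeff (p ⊗ q) i ≡ conv (coeff p) (coeff q) i
coeff-⊗ []      q i =
  sym (conv-zero (coeff []) (coeff q) i λ j l _ → ℤ.*-zeroˡ (coeff q l))
coeff-⊗ (a ∷ p) q zero =
  trans (coeff-⊕ (map (a *ℤ_) q) (0ℤ ∷ (p ⊗ q)) 0)
    (trans (ℤ.+-identityʳ _) (coeff-map-* a q 0))
coeff-⊗ (a ∷ p) q (suc i) =
  trans (coeff-⊕ (map (a *ℤ_) q) (0ℤ ∷ (p ⊗ q)) (suc i))
    (cong₂ _+ℤ_ (coeff-map-* a q (suc i)) (coeff-⊗ p q i))

-- Extreme coefficients and degree.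

coeff-last : ∀ {n} (v : Vec ℤ (suc n)) → coeff (toList v) n ≡ last v
coeff-last {zero}  (x ∷ [])    = refl
coeff-last {suc n} (x ∷ y ∷ v) = coeff-last (y ∷ v)

coeff-head : ∀ {n} (v : Vec ℤ (suc n)) → coeff (toList v) 0 ≡ head v
coeff-head (x ∷ v) = refl

coeff-above : ∀ {n} (v : Vec ℤ n) i → n ≤ i → coeff (toList v) i ≡ 0ℤ
coeff-above []      i       _         = refl
coeff-above (x ∷ v) (suc i) (s≤s n≤i) = coeff-above v i n≤i

head-∈ : ∀ {n} {P : ℤ → Set} {v : Vec ℤ (suc n)} → Vec.All P v → P (head v)
head-∈ (px Vec.∷ _) = px

last-∈ : ∀ {n} {P : ℤ → Set} {v : Vec ℤ (suc n)} → Vec.All P v → P (last v)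
last-∈ {zero}  {v = x ∷ []}    (px Vec.∷ Vec.[]) = px
last-∈ {suc n} {v = x ∷ y ∷ v} (px Vec.∷ pv)     = last-∈ {v = y ∷ v} pv

HasDegree-unique : ∀ {p m n} → HasDegree p m → HasDegree p n → m ≡ n
HasDegree-unique (pm , >m) (pn , >n) =
  ℕ.≤-antisym (ℕ.≮⇒≥ λ n<m → pm (>n _ n<m)) (ℕ.≮⇒≥ λ m<n → pn (>m _ m<n))

-- Factorisations of nonzero integers into two factors.

-- The value at e = 0, which is not a divisor of a ≢ 0, is junk.
factorPair : ℤ → Sign.Sign → ℕ → ℤ × ℤ
factorPair a s zero      = 0ℤ , 0ℤ
factorPair a s e@(suc _) = s ◃ e , (s Sign.* sign a) ◃ (∣ a ∣ / e)

-- For `a` nonzero, a pair with product `a` is determined by the absolute value of its first entry,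
-- a positive divisor of `a`, and by the sign of that entry.
factorisations : ℤ → List (ℤ × ℤ)
factorisations a = concatMap (λ e → factorPair a Sign.+ e ∷ factorPair a Sign.- e ∷ [])
  (filter (_∣? ∣ a ∣) (map suc (upTo ∣ a ∣)))

length-factorisations : ∀ a → length (factorisations a) ≡ d a * 2
length-factorisations a = length-concatMap _
  (All.universal (λ _ → refl) (filter (_∣? ∣ a ∣) (map suc (upTo ∣ a ∣))))

-- The second factor is recovered from the product because a sign squares to `+` and `∣ x ∣`
-- cancels. The variable `m` stands for `∣ x ∣` so that matching on it lets `factorPair` reduce.
factorPair-* : ∀ x y {m} → ∣ x ∣ ≡ m → x *ℤ y ≢ 0ℤ → factorPair (x *ℤ y) (sign x) m ≡ (x , y)
factorPair-* x y {zero}  ∣x∣≡ xy≢0 = contradiction (0*≡0 {x} y (ℤ.∣i∣≡0⇒i≡0 ∣x∣≡)) xy≢0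
factorPair-* x y {suc e} ∣x∣≡ xy≢0 = cong₂ _,_
    (trans (cong (sign x ◃_) (sym ∣x∣≡)) (ℤ.signᵢ◃∣i∣≡i x))
    (trans (cong₂ _◃_ sign≡ abs≡) (ℤ.signᵢ◃∣i∣≡i y))
  where
  open ≡-Reasoning
  sign≡ : sign x Sign.* sign (x *ℤ y) ≡ sign y
  sign≡ = begin
    sign x Sign.* sign (x *ℤ y)           ≡⟨ cong (sign x Sign.*_) (ℤ.sign-* x y {{≢-nonZero xy≢0}}) ⟩
    sign x Sign.* (sign x Sign.* sign y)  ≡⟨ Sign.*-assoc (sign x) (sign x) (sign y) ⟨
    (sign x Sign.* sign x) Sign.* sign y  ≡⟨ cong (Sign._* sign y) (Sign.s*s≡+ (sign x)) ⟩
    sign y                                ∎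
  abs≡ : ∣ x *ℤ y ∣ / suc e ≡ ∣ y ∣
  abs≡ = begin
    ∣ x *ℤ y ∣ / suc e      ≡⟨ cong (_/ suc e) (ℤ.abs-* x y) ⟩
    ∣ x ∣ * ∣ y ∣ / suc e   ≡⟨ cong (λ m → m * ∣ y ∣ / suc e) ∣x∣≡ ⟩
    suc e * ∣ y ∣ / suc e   ≡⟨ cong (_/ suc e) (ℕ.*-comm (suc e) ∣ y ∣) ⟩
    ∣ y ∣ * suc e / suc e   ≡⟨ m*n/n≡m ∣ y ∣ (suc e) ⟩
    ∣ y ∣                   ∎

∈-map-suc-upTo : ∀ {e m} .{{_ : NonZero e}} → e ≤ m → e ∈ map suc (upTo m)
∈-map-suc-upTo {suc e} e<m = ∈-map⁺ suc (∈-upTo⁺ e<m)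

∈-factorisations : ∀ x y → x *ℤ y ≢ 0ℤ → (x , y) ∈ factorisations (x *ℤ y)
∈-factorisations x y xy≢0 = ∈-concatMap⁺ _ (lose ∣x∣-divides
  (signs (sign x) (sym (factorPair-* x y refl xy≢0))))
  where
  -- The first instance keeps `∣ x ∣` out of the junk case 0; the second gives
  -- `∣ x ∣ ≤ ∣ x ∣ * ∣ y ∣`.
  instance
    _ = ≢-nonZero (xy≢0 ∘ 0*≡0 {x} y)
    _ = ≢-nonZero (xy≢0 ∘ *0≡0 x {y})
  ∣x∣-divides : ∣ x ∣ ∈ filter (_∣? ∣ x *ℤ y ∣) (map suc (upTo ∣ x *ℤ y ∣))
  ∣x∣-divides rewrite ℤ.abs-* x y = ∈-filter⁺ (_∣? (∣ x ∣ * ∣ y ∣))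
    (∈-map-suc-upTo (ℕ.m≤m*n ∣ x ∣ ∣ y ∣)) (m∣m*n ∣ y ∣)
  signs : ∀ s {z} → z ≡ factorPair (x *ℤ y) s ∣ x ∣ →
    z ∈ factorPair (x *ℤ y) Sign.+ ∣ x ∣ ∷ factorPair (x *ℤ y) Sign.- ∣ x ∣ ∷ []
  signs Sign.+ = here
  signs Sign.- = there ∘ here

factorisationsOf : List ℤ → List (ℤ × ℤ)
factorisationsOf S = concatMap factorisations (S ∖0)

∈-factorisationsOf : ∀ {S a} x y → a ∈ S → a ≢ 0ℤ → x *ℤ y ≡ a → (x , y) ∈ factorisationsOf S
∈-factorisationsOf x y a∈S a≢0 refl =
  ∈-concatMap⁺ factorisations
    (lose (∈-filter⁺ (λ a → ¬? (a ≟ 0ℤ)) a∈S a≢0) (∈-factorisations x y a≢0))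

length-concatMap-factorisations : ∀ as → length (concatMap factorisations as) ≡ sum (map d as) * 2
length-concatMap-factorisations []       = refl
length-concatMap-factorisations (a ∷ as) =
  trans (length-++ (factorisations a))
    (trans (cong₂ _+_ (length-factorisations a) (length-concatMap-factorisations as))
      (sym (ℕ.*-distribʳ-+ 2 (d a) _)))

-- Congruence modulo `M`.

neg-diff : ∀ a b → - (a - b) ≡ b - a
neg-diff = ℤ-Solver.solve-∀

diff-trans : ∀ a b c → (a - b) +ℤ (b - c) ≡ a - c
diff-trans = ℤ-Solver.solve-∀

diff-+ : ∀ a a′ b b′ → (a - a′) +ℤ (b - b′) ≡ (a +ℤ b) - (a′ +ℤ b′)
diff-+ = ℤ-Solver.solve-∀

diff-* : ∀ a a′ b b′ → b *ℤ (a - a′) +ℤ a′ *ℤ (b - b′) ≡ a *ℤ b - a′ *ℤ b′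
diff-* = ℤ-Solver.solve-∀

module Residues (M : ℕ) .{{_ : NonZero M}} where

  infix 4 _≅_
  -- A record, so that unification can recover `a` and `b` from the type, which the bare difference
  -- `a - b` would not allow.
  record _≅_ (a b : ℤ) : Set where
    constructor ∣-diff
    field divides : (+ M) Signed.∣ (a - b)

  ≅⇒≡mod : ∀ {a b} → a ≅ b → a ≡ b mod M
  ≅⇒≡mod (∣-diff M∣) = Signed.∣⇒∣ᵤ M∣

  ≅-reflexive : ∀ {a b} → a ≡ b → a ≅ b
  ≅-reflexive {a} refl = ∣-diff (Signed.divides 0ℤ (ℤ.+-inverseʳ a))

  ≅-sym : ∀ {a b} → a ≅ b → b ≅ a
  ≅-sym {a} {b} (∣-diff M∣) = ∣-diff (subst (_ Signed.∣_) (neg-diff a b) (Signed.∣m⇒∣-m M∣))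

  ≅-trans : ∀ {a b c} → a ≅ b → b ≅ c → a ≅ c
  ≅-trans {a} {b} {c} (∣-diff M∣) (∣-diff M∣′) =
    ∣-diff (subst (_ Signed.∣_) (diff-trans a b c) (Signed.∣m∣n⇒∣m+n M∣ M∣′))

  +-cong-≅ : ∀ {a a′ b b′} → a ≅ a′ → b ≅ b′ → a +ℤ b ≅ a′ +ℤ b′
  +-cong-≅ {a} {a′} {b} {b′} (∣-diff M∣) (∣-diff M∣′) =
    ∣-diff (subst (_ Signed.∣_) (diff-+ a a′ b b′) (Signed.∣m∣n⇒∣m+n M∣ M∣′))

  *-cong-≅ : ∀ {a a′ b b′} → a ≅ a′ → b ≅ b′ → a *ℤ b ≅ a′ *ℤ b′
  *-cong-≅ {a} {a′} {b} {b′} (∣-diff M∣) (∣-diff M∣′) =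
    ∣-diff (subst (_ Signed.∣_) (diff-* a a′ b b′)
      (Signed.∣m∣n⇒∣m+n (Signed.∣n⇒∣m*n b M∣) (Signed.∣n⇒∣m*n a′ M∣′)))

  conv-cong-≅ : ∀ {F F′ G G′} → (∀ i → F i ≅ F′ i) → (∀ i → G i ≅ G′ i) →
    ∀ i → conv F G i ≅ conv F′ G′ i
  conv-cong-≅ F≅ G≅ zero    = *-cong-≅ (F≅ 0) (G≅ 0)
  conv-cong-≅ F≅ G≅ (suc i) =
    +-cong-≅ (*-cong-≅ (F≅ 0) (G≅ (suc i))) (conv-cong-≅ (F≅ ∘ suc) G≅ i)

  infix 4 _≋_
  _≋_ : Poly → Poly → Set
  p ≋ q = ∀ i → coeff p i ≅ coeff q i

  ⊗-cong-≋ : ∀ p p′ q q′ → p ≋ p′ → q ≋ q′ → p ⊗ q ≋ p′ ⊗ q′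
  ⊗-cong-≋ p p′ q q′ p≋ q≋ i =
    ≅-trans (≅-reflexive (coeff-⊗ p q i))
      (≅-trans (conv-cong-≅ p≋ q≋ i) (≅-reflexive (sym (coeff-⊗ p′ q′ i))))

  ∷-cong-≋ : ∀ {a b} p q → a ≅ b → p ≋ q → a ∷ p ≋ b ∷ q
  ∷-cong-≋ p q a≅b p≋q zero    = a≅b
  ∷-cong-≋ p q a≅b p≋q (suc i) = p≋q i

  ≅-%ℕ : ∀ a → a ≅ + (a %ℕ M)
  ≅-%ℕ a = ∣-diff (Signed.divides (a /ℕ M)
    (trans (cong (_- + (a %ℕ M)) (a≡a%ℕn+[a/ℕn]*n a M)) (cancel (+ (a %ℕ M)) ((a /ℕ M) *ℤ + M))))
    where
    cancel : ∀ r t → (r +ℤ t) - r ≡ t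
    cancel = ℤ-Solver.solve-∀

  -- Polynomials modulo `M` with a fixed leading coefficient.

  -- One representative modulo M of every polynomial of degree k with leading
  -- coefficient exactly c.
  residuePolys : ℕ → ℤ → List Poly
  residuePolys zero    c = (c ∷ []) ∷ []
  residuePolys (suc k) c = cartesianProductWith (λ r p → + r ∷ p) (upTo M) (residuePolys k c)

  length-residuePolys : ∀ k c → length (residuePolys k c) ≡ M ^ k
  length-residuePolys zero    c = refl
  length-residuePolys (suc k) c =
    trans (length-cartesianProductWith _ (upTo M) (residuePolys k c))
      (cong₂ _*_ (length-upTo M) (length-residuePolys k c))

  residuePolys-complete : ∀ p k → HasDegree p k →
    ∃ λ p′ → p′ ∈ residuePolys k (coeff p k) × p ≋ p′
  residuePolys-complete []      k       (pk , _) = contradiction refl pk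
  residuePolys-complete (a ∷ p) zero    (_ , >0) =
    -- The representative drops the trailing zeros that `p` may carry.
    a ∷ [] , here refl , λ { zero → ≅-reflexive refl ; (suc i) → ≅-reflexive (>0 (suc i) (s≤s z≤n)) }
  residuePolys-complete (a ∷ p) (suc k) (pk , >k)
    with p′ , p′∈ , p≋p′ ← residuePolys-complete p k (pk , λ i k<i → >k (suc i) (s≤s k<i)) =
    + (a %ℕ M) ∷ p′ , ∈-cartesianProductWith⁺ _ (∈-upTo⁺ (n%ℕd<d a M)) p′∈ , ∷-cong-≋ p p′ (≅-%ℕ a) p≋p′

  -- Codes of reducible polynomials.

  module _ (S : List ℤ) where

    -- The argument holds the constant terms, then the leading coefficients. With both kept exactly,
    -- a factor of degree `k + 1` has just `k` coefficients left to choose modulo `M`.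
    codesWith : (k l : ℕ) → (ℤ × ℤ) × (ℤ × ℤ) → List (Poly × Poly)
    codesWith k l ((p₀ , q₀) , (pₖ , qₗ)) =
      cartesianProductWith (λ p q → p₀ ∷ p , q₀ ∷ q) (residuePolys k pₖ) (residuePolys l qₗ)

    -- Here k + 1 and n ∸ 2 ∸ k + 1 are the degrees of the two factors.
    codesAt : ℕ → ℕ → List (Poly × Poly)
    codesAt n k = concatMap (codesWith k (n ∸ 2 ∸ k))
      (cartesianProduct (factorisationsOf S) (factorisationsOf S))

    -- The degree `k + 1` of the first factor runs through `1 … n - 1`; for `n = 1` there are no
    -- codes.
    codes : ℕ → List (Poly × Poly)
    codes n = concatMap (codesAt n) (upTo (n ∸ 1))

    length-codesWith : ∀ k l e → length (codesWith k l e) ≡ M ^ (k + l)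
    length-codesWith k l (_ , (pₖ , qₗ)) =
      trans (length-cartesianProductWith _ (residuePolys k pₖ) (residuePolys l qₗ))
        (trans (cong₂ _*_ (length-residuePolys k pₖ) (length-residuePolys l qₗ))
          (sym (ℕ.^-distribˡ-+-* M k l)))

    -- There are `n ∸ 1` degrees, `(2 D) ^ 2` choices of two factorisations and `M ^ (n ∸ 2)`
    -- choices of residues; the 4 comes from the two signs.
    length-codes : ∀ n → length (codes n) ≡ 4 * (n ∸ 1) * M ^ (n ∸ 2) * sum (map d (S ∖0)) ^ 2
    length-codes n = begin
      length (codes n)
        ≡⟨ length-concatMap (codesAt n) (All.map atDegree (all-upTo (n ∸ 1))) ⟩
      length (upTo (n ∸ 1)) * (D * 2 * (D * 2) * M ^ (n ∸ 2))
        ≡⟨ cong (_* (D * 2 * (D * 2) * M ^ (n ∸ 2))) (length-upTo (n ∸ 1)) ⟩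
      (n ∸ 1) * (D * 2 * (D * 2) * M ^ (n ∸ 2))
        ≡⟨ rearrange (n ∸ 1) D (M ^ (n ∸ 2)) ⟩
      4 * (n ∸ 1) * M ^ (n ∸ 2) * D ^ 2 ∎
      where
      open ≡-Reasoning
      D = sum (map d (S ∖0))
      rearrange : ∀ m D x → m * (D * 2 * (D * 2) * x) ≡ 4 * m * x * (D * (D * 1))
      rearrange = solve-∀
      pairs = factorisationsOf S
      atDegree : ∀ {k} → k < n ∸ 1 → length (codesAt n k) ≡ D * 2 * (D * 2) * M ^ (n ∸ 2)
      atDegree {k} k< = begin
        length (codesAt n k)
          ≡⟨ length-concatMap (codesWith k (n ∸ 2 ∸ k))
               (All.universal (length-codesWith k (n ∸ 2 ∸ k)) (cartesianProduct pairs pairs)) ⟩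
        length (cartesianProduct pairs pairs) * M ^ (k + (n ∸ 2 ∸ k))
          ≡⟨ cong₂ _*_
               (trans (length-cartesianProductWith _,_ pairs pairs)
                 (cong₂ _*_ (length-concatMap-factorisations (S ∖0)) (length-concatMap-factorisations (S ∖0))))
               -- Subtraction is truncated, so cancelling `k` requires `k ≤ n ∸ 2`, which follows
               -- from `k < n ∸ 1`.
               (cong (M ^_) (ℕ.m+[n∸m]≡n (subst (k ≤_) (ℕ.pred[m∸n]≡m∸[1+n] n 1) (ℕ.<⇒≤pred k<)))) ⟩
        D * 2 * (D * 2) * M ^ (n ∸ 2) ∎

    -- A relation rather than a function, since a polynomial may factor in several ways; the product
    -- of a code agrees with the polynomial only modulo `M`.
    Encodes : ∀ {n} → Vec ℤ (suc n) → Poly × Poly → Set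
    Encodes v (p , q) = toList v ≋ p ⊗ q

    -- Keep the constant terms of `p` and `q` and replace their tails by representatives; the
    -- product is unchanged modulo `M`.
    codesAt-complete : ∀ {n} (v : Vec ℤ (suc n)) p q k l → n ≡ suc k + suc l →
      HasDegree p (suc k) → HasDegree q (suc l) → toList v ≈ p ⊗ q →
      (coeff p 0 , coeff q 0) ∈ factorisationsOf S →
      (coeff p (suc k) , coeff q (suc l)) ∈ factorisationsOf S →
      Any (Encodes v) (codesAt n k)
    codesAt-complete v [] q k l _ (pk , _) = contradiction refl pk
    codesAt-complete v (_ ∷ _) [] k l _ _ (ql , _) = contradiction refl ql
    codesAt-complete {n} v (p₀ ∷ p) (q₀ ∷ q) k l n≡ (pk , >k) (ql , >l) v≈pq ∈₀ ∈ₙ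
      with p′ , p′∈ , p≋p′ ← residuePolys-complete p k (pk , λ i k<i → >k (suc i) (s≤s k<i))
         | q′ , q′∈ , q≋q′ ← residuePolys-complete q l (ql , λ i l<i → >l (suc i) (s≤s l<i)) =
      lose {x = p₀ ∷ p′ , q₀ ∷ q′}
        (∈-concatMap⁺ _ (lose (∈-cartesianProduct⁺ ∈₀ ∈ₙ)
          (∈-cartesianProductWith⁺ _ p′∈ (subst (λ j → q′ ∈ residuePolys j (coeff q l)) (sym l≡) q′∈))))
        λ i → ≅-trans (≅-reflexive (v≈pq i))
          (⊗-cong-≋ (p₀ ∷ p) (p₀ ∷ p′) (q₀ ∷ q) (q₀ ∷ q′)
            (∷-cong-≋ p p′ (≅-reflexive refl) p≋p′) (∷-cong-≋ q q′ (≅-reflexive refl) q≋q′) i)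
      where
      l≡ : n ∸ 2 ∸ k ≡ l
      l≡ = trans (cong (λ m → m ∸ 2 ∸ k) (trans n≡ (cong suc (ℕ.+-suc k l)))) (ℕ.m+n∸m≡n k l)

    codes-complete : ∀ n {v : Vec ℤ (suc n)} → ℛ* S n v → Any (Encodes v) (codes n)
    codes-complete n {v} (v∈S , a₀aₙ≢0 , p , q , (suc k , _ , pk , >k) , (suc l , _ , ql , >l) , v≈pq) =
      concatMap⁺ (codesAt n) (lose (∈-upTo⁺ k<) (codesAt-complete v p q k l n≡ (pk , >k) (ql , >l) v≈pq
        (∈-factorisationsOf _ _ (head-∈ v∈S) a₀≢0
          (trans (sym (v≈conv 0)) (coeff-head v)))
        (∈-factorisationsOf _ _ (last-∈ v∈S) aₙ≢0 top)))
      where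
      a₀≢0 : head v ≢ 0ℤ
      a₀≢0 a₀≡0 = a₀aₙ≢0 (0*≡0 (last v) a₀≡0)
      aₙ≢0 : last v ≢ 0ℤ
      aₙ≢0 aₙ≡0 = a₀aₙ≢0 (*0≡0 (head v) aₙ≡0)
      v≈conv : ∀ i → coeff (toList v) i ≡ conv (coeff p) (coeff q) i
      v≈conv i = trans (v≈pq i) (coeff-⊗ p q i)
      lead : coeff (toList v) (suc k + suc l) ≡ coeff p (suc k) *ℤ coeff q (suc l)
      lead = trans (v≈conv _) (conv-top (coeff p) (coeff q) (suc k) (suc l) >k >l)
      n≡ : n ≡ suc k + suc l
      -- The degree is found twice: it is `n` because the last entry is nonzero, and the sum of the
      -- degrees of `p` and `q` because the integers have no zero divisors.
      n≡ = HasDegree-unique {toList v}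
        ((λ eq → aₙ≢0 (trans (sym (coeff-last v)) eq)) , λ i n<i → coeff-above v i n<i)
        ( (λ eq → prod≢0 (trans (sym lead) eq))
        , λ i <i → trans (v≈conv i) (conv-vanishesAbove {coeff p} {coeff q} >k >l i <i))
        where
        prod≢0 : coeff p (suc k) *ℤ coeff q (suc l) ≢ 0ℤ
        prod≢0 eq with ℤ.i*j≡0⇒i≡0∨j≡0 (coeff p (suc k)) eq
        ... | inj₁ pk≡0 = pk pk≡0
        ... | inj₂ ql≡0 = ql ql≡0
      top : coeff p (suc k) *ℤ coeff q (suc l) ≡ last v
      top = trans (sym lead) (trans (cong (coeff (toList v)) (sym n≡)) (coeff-last v))
      k< : k < n ∸ 1
      k< = subst (λ m → k < m ∸ 1) (sym n≡) (subst (k <_) (sym (ℕ.+-suc k l)) (s≤s (ℕ.m≤m+n k l)))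

    -- Recovering a polynomial from its code.

    module _ (separates : (i j : Fin (length S)) → i ≢ j → ¬ (lookup S i ≡ lookup S j mod M)) where

      -- Separation concerns positions in `S`, so the positions of `a` and `b` are compared: if they
      -- differed, the congruence would contradict `separates`.
      ≅⇒≡ : ∀ {a b} → a ∈ S → b ∈ S → a ≅ b → a ≡ b
      ≅⇒≡ a∈ b∈ a≅b with index a∈ Fin.≟ index b∈
      ... | yes i≡j = trans (lookup-index a∈) (trans (cong (lookup S) i≡j) (sym (lookup-index b∈)))
      ... | no  i≢j = contradiction
        (≅⇒≡mod (≅-trans (≅-reflexive (sym (lookup-index a∈))) (≅-trans a≅b (≅-reflexive (lookup-index b∈)))))
        (separates _ _ i≢j)

      ≋⇒≡ : ∀ {n} {v w : Vec ℤ n} → Vec.All (_∈ S) v → Vec.All (_∈ S) w →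
        toList v ≋ toList w → v ≡ w
      ≋⇒≡ Vec.[]        Vec.[]        _   = refl
      ≋⇒≡ (a∈ Vec.∷ v∈) (b∈ Vec.∷ w∈) v≋w =
        cong₂ _∷_ (≅⇒≡ a∈ b∈ (v≋w 0)) (≋⇒≡ v∈ w∈ (v≋w ∘ suc))

      -- Both polynomials are congruent to the product of the code `c`, hence to each other, and
      -- their coefficients lie in `S`.
      Encodes-injective : ∀ {n} {v w : Vec ℤ (suc n)} c → ℛ* S n v → ℛ* S n w →
        Encodes v c → Encodes w c → v ≡ w
      Encodes-injective c (v∈ , _) (w∈ , _) v≋ w≋ =
        ≋⇒≡ v∈ w∈ λ i → ≅-trans (v≋ i) (≅-sym (w≋ i))

theorem2p1 : (S : List ℤ) → Unique S →
    (n : ℕ) → 1 ≤ n →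
    (M : ℕ) .{{_ : NonZero M}} →
    ((i j : Fin (length S)) → i ≢ j → ¬ (lookup S i ≡ lookup S j mod M)) →
    CardinalityAtMost (ℛ* S n) (4 * (n ∸ 1) * M ^ (n ∸ 2) * (sum (map d (S ∖0))) ^ 2)
theorem2p1 S _ n _ M separates vs vs! vs∈ℛ* =
  subst (length vs ≤_) (length-codes S n)
    (pigeonhole (Encodes S) (Encodes-injective S separates) vs (codes S n) vs! vs∈ℛ*
      (All.map (codes-complete S n) vs∈ℛ*))
  where open Residues M
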